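{- Let $\mathcal J$ be an ideal on $\omega$ which is a $P^+(\mathcal J)$-ideal and is $\le_{KB}$-homogeneous. (1) Assume CH. The following conditions are equivalent: (a) $\mathcal{ED}_{\mathrm{Fin}}\not\le_{KB}\mathcal J$; (b) there is a Q-point which is not a $\mathcal J$-point; (c) there is a Q-point which is not a weak $\mathcal J$-ultrafilter. (2) If $\mathcal J$ is $F_\sigma$, then CH can be relaxed to the assumption $\mathfrak p=\mathfrak c$ in (1).
   Context: An ideal on a set $X$ is a family of subsets of $X$ closed under finite unions and subsets, containing all finite subsets of $X$ and not containing $X$; $\mathcal J^+=\mathcal P(X)\setminus\mathcal J$. $F_\sigma$ refers to the topology of $\mathcal P(\omega)\cong\{0,1\}^\omega$. $\mathfrak c=2^{\aleph_0}$, and $\mathfrak p$ is the usual pseudointersection number. With $\Delta=\{(n,k)\in\omega^2:n\ge k\}$, $\mathcal{ED}_{\mathrm{Fin}}=\{A\subseteq\Delta:\exists m\ \forall n\ |\{k:(n,k)\in A\}|<m\}$, an ideal on $\Delta$. For ideals $\mathcal I$ on $X$ and $\mathcal K$ on $Y$, $\mathcal I\le_{KB}\mathcal K$ ($\mathcal I\le_P\mathcal K$) means that there is a finite-to-one (one-to-one, respectively) function $f:Y\to X$ with $f^{ -1}[B]\in\mathcal K$ for all $B\in\mathcal I$. $\mathcal J$ is a $P^+(\mathcal J)$-ideal if for each decreasing sequence $A_0\supseteq A_1\supseteq\dots$ of sets from $\mathcal J^+$ there is $B\in\mathcal J^+$ with $B\setminus A_n\in\mathcal J$ for all $n$. For $A\in\mathcal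 J^+$, $\mathcal J\restriction A=\{B\cap A:B\in\mathcal J\}$ (an ideal on $A$); $\mathcal J$ is $\le_{KB}$-homogeneous if $\mathcal J\restriction A\le_{KB}\mathcal J$ and $\mathcal J\le_{KB}\mathcal J\restriction A$ for every $A\in\mathcal J^+$. Ultrafilters on $\omega$ contain all cofinite sets; $\mathcal U^*=\{\omega\setminus A:A\in\mathcal U\}$. $\mathcal U$ is a weak $\mathcal J$-ultrafilter ($\mathcal J$-point) if $\mathcal J\not\le_{KB}\mathcal U^*$ ($\mathcal J\not\le_P\mathcal U^*$, respectively). $\mathcal U$ is a Q-point if for each partition $\{A_n:n\in\omega\}$ of $\omega$ into finite sets there is $A\in\mathcal U$ with $|A\cap A_n|=1$ for each $n$. -}

module Defs where

open import Level using (0ℓ)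
open import Data.Bool.Base using (Bool; true; false; _∧_; _∨_; not)
open import Data.Fin.Base using (toℕ)
open import Data.Fin.Properties using (toℕ≤pred[n])
open import Data.Fin.Subset using (Subset; ∣_∣)
open import Data.List.Base using (List; foldr)
open import Data.List.Membership.Propositional using () renaming (_∈_ to _∈ˡ_)
open import Data.List.Relation.Unary.All using (All)
open import Data.Nat.Base using (ℕ; suc; _≤_; _<_)
open import Data.Product using (Σ; ∃; ∃!; _×_; _,_; proj₁; proj₂)
open import Data.Sum.Base using (_⊎_)
open import Data.Vec.Base using (tabulate)
open import Function.Base using (_∘_)
open import Function.Bundles using (_↣_; _⤖_; _⇔_)
open import Function.Definitions using (Injective)
open import Relation.Binary.PropositionalEquality using (_≡_; _≢_; _≗_)
open import Relation.Nullary.Negation.Core using (¬_)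
open import Relation.Unary using (Pred) renaming (∁ to ∁ᵖ)

private
  variable
    X Y : Set

infix  4 _∈_ _⊆_ _≤KB_ _≤P_ _≺_
infixr 7 _∩_
infixr 6 _∪_
infixl 7 _∖_
infix  8 _↾_

-- A subset of X is its characteristic function, so 𝒫 ℕ is the Cantor space
-- {0,1}^ω.  Under excluded middle every predicate on X has a characteristic
-- function, and under function extensionality _≡_ on 𝒫 X is equality of sets.

𝒫 : Set → Set
𝒫 X = X → Bool

_∈_ : X → 𝒫 X → Set
x ∈ A = A x ≡ true

_⊆_ : 𝒫 X → 𝒫 X → Set
A ⊆ B = ∀ {x} → x ∈ A → x ∈ B

full : 𝒫 X
full _ = true

∅ : 𝒫 X
∅ _ = false

_∩_ _∪_ _∖_ : 𝒫 X → 𝒫 X → 𝒫 X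
(A ∩ B) x = A x ∧ B x
(A ∪ B) x = A x ∨ B x
(A ∖ B) x = A x ∧ not (B x)

∁ : 𝒫 X → 𝒫 X
∁ A = not ∘ A

-- The type of elements of A.  The membership proof is unique, so Elem A has
-- exactly one inhabitant for each element of A.

Elem : 𝒫 X → Set
Elem A = ∃ (_∈ A)

Finite : 𝒫 X → Set
Finite {X} A = ∃ λ (xs : List X) → ∀ {x} → x ∈ A → x ∈ˡ xs

Infinite : 𝒫 X → Set
Infinite A = ¬ Finite A

FiniteToOne : (Y → X) → Set
FiniteToOne {Y} {X} f = ∀ x → ∃ λ (ys : List Y) → ∀ {y} → f y ≡ x → y ∈ˡ ys

Family : Set → Set₁
Family X = Pred (𝒫 X) 0ℓ

record IsIdeal (J : Family X) : Set where
  field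
    ∪-closed : ∀ {A B} → J A → J B → J (A ∪ B)
    ⊆-closed : ∀ {A B} → A ⊆ B → J B → J A
    finite   : ∀ {A} → Finite A → J A
    proper   : ¬ J full

infix 9 _⁺ _*

_⁺ : Family X → Family X
(J ⁺) A = ¬ J A

-- The restricted ideal lives on the type Elem A; as a subset of that type,
-- B ∩ A is B ∘ proj₁.

_↾_ : Family X → (A : 𝒫 X) → Family (Elem A)
(J ↾ A) C = ∃ λ B → J B × C ≗ (B ∘ proj₁)

_≤KB_ : Family X → Family Y → Set
_≤KB_ {X} {Y} I K =
  ∃ λ (f : Y → X) → FiniteToOne f × (∀ B → I B → K (B ∘ f))

_≤P_ : Family X → Family Y → Set
_≤P_ {X} {Y} I K =
  ∃ λ (f : Y → X) → Injective _≡_ _≡_ f × (∀ B → I B → K (B ∘ f))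

Homogeneous-KB : Family X → Set
Homogeneous-KB J = ∀ A → (J ⁺) A → (J ↾ A ≤KB J) × (J ≤KB J ↾ A)

IsP⁺ : Family X → Set
IsP⁺ {X} J =
  ∀ (A : ℕ → 𝒫 X) → (∀ n → A (suc n) ⊆ A n) → (∀ n → (J ⁺) (A n)) →
  ∃ λ B → (J ⁺) B × (∀ n → J (B ∖ A n))

Δ : Set
Δ = Σ (ℕ × ℕ) λ (n , k) → k ≤ n

-- {k : (n,k) ∈ A} only contains numbers k ≤ n, hence is a subset of Fin (suc n).

column : 𝒫 Δ → (n : ℕ) → Subset (suc n)
column A n = tabulate λ k → A ((n , toℕ k) , toℕ≤pred[n] k)

EDFin : Family Δ
EDFin A = ∃ λ m → ∀ n → ∣ column A n ∣ < m

record IsUltrafilter (U : Family ℕ) : Set where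
  field
    ∩-closed : ∀ {A B} → U A → U B → U (A ∩ B)
    ⊆-closed : ∀ {A B} → A ⊆ B → U A → U B
    cofinite : ∀ {A} → Finite (∁ A) → U A
    proper   : ¬ U ∅
    ultra    : ∀ A → U A ⊎ U (∁ A)

_* : Family X → Family X
(U *) B = ∃ λ A → U A × B ≗ ∁ A

IsWeakUltrafilter : Family ℕ → Family ℕ → Set
IsWeakUltrafilter J U = ¬ (J ≤KB U *)

IsPoint : Family ℕ → Family ℕ → Set
IsPoint J U = ¬ (J ≤P U *)

record IsFinitePartition (P : ℕ → 𝒫 ℕ) : Set where
  field
    nonempty : ∀ n → ∃ λ x → x ∈ P n
    disjoint : ∀ {m n} → m ≢ n → ∀ x → ¬ (x ∈ P m ∩ P n)
    cover    : ∀ x → ∃ λ n → x ∈ P n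
    finite   : ∀ n → Finite (P n)

record IsQPoint (U : Family ℕ) : Set where
  field
    isUltrafilter : IsUltrafilter U
    selector      : ∀ P → IsFinitePartition P →
                    ∃ λ A → U A × (∀ n → ∃! _≡_ λ x → x ∈ A ∩ P n)

-- Topology of 𝒫 ℕ: the sets of all B agreeing with A below n are a base of
-- the product topology.

Open : Family ℕ → Set
Open O = ∀ A → O A → ∃ λ n → ∀ B → (∀ i → i < n → A i ≡ B i) → O B

Closed : Family ℕ → Set
Closed C = Open (∁ᵖ C)

Fσ : Family ℕ → Set₁
Fσ J = ∃ λ (C : ℕ → Family ℕ) →
  (∀ n → Closed (C n)) × (∀ A → J A ⇔ ∃ λ n → C n A)

_≺_ : Set → Set → Set
X ≺ Y = (X ↣ Y) × ¬ (Y ↣ X)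

-- No cardinality lies strictly between ℵ₀ and 2^ℵ₀.

CH : Set₁
CH = ¬ (∃ λ (X : Set) → (ℕ ≺ X) × (X ≺ 𝒫 ℕ))

⋂ : List (𝒫 X) → 𝒫 X
⋂ = foldr _∩_ full

StrongFIP : 𝒫 (𝒫 ℕ) → Set
StrongFIP 𝓕 = ∀ As → All (_∈ 𝓕) As → Infinite (⋂ As)

IsPseudointersection : 𝒫 ℕ → 𝒫 (𝒫 ℕ) → Set
IsPseudointersection P 𝓕 = Infinite P × (∀ A → A ∈ 𝓕 → Finite (P ∖ A))

𝔭-Witness : 𝒫 (𝒫 ℕ) → Set
𝔭-Witness 𝓕 = StrongFIP 𝓕 × ¬ (∃ λ P → IsPseudointersection P 𝓕)

-- 𝔠 is the least cardinality of a family with the strong finite intersection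
-- property and no infinite pseudointersection.

𝔭≡𝔠 : Set
𝔭≡𝔠 = (∃ λ 𝓕 → 𝔭-Witness 𝓕 × (Elem 𝓕 ⤖ 𝒫 ℕ))
    × (∀ 𝓕 → 𝔭-Witness 𝓕 → 𝒫 ℕ ↣ Elem 𝓕)

{-# OPTIONS --safe #-}
module Submission where

-- cond-b implies cond-c because injections are finite-to-one.
--
-- cond-c implies cond-a.  EDFin is not Katetov-Blass below the dual ideal of a
-- Q-point U: given a finite-to-one f from ω to Δ, the Q-point property yields a
-- set A in U that f maps to points of Δ in distinct columns.  The image of A is
-- in EDFin, although its preimage contains A (QPoint.EDFin≰U*).  As ≤KB is
-- transitive, EDFin ≤KB J would prevent J ≤KB U*.
--
-- cond-a implies cond-b.  By homogeneity, EDFin is not below any restriction of J to a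
-- positive set B.  Hence for every partition into finite sets, B has a positive
-- subset that meets each block in at most one point (selective): otherwise all
-- such partial selectors are in J, and a map that sends each block injectively
-- into a column pulls every set of EDFin back to a finite union of partial
-- selectors, hence into J.
--
-- The sets w of natural numbers are well-ordered so that no proper initial
-- segment has size continuum (Zermelo, initial-well-order).  Along this order a
-- tower of J-positive sets, decreasing modulo J, is built: the set at stage w is
-- a positive lower bound modulo J of the earlier ones, is included in w or
-- disjoint from w, and is a partial selector of the partition coded by w
-- (module Tower).  The sets that contain a member of the tower modulo J form a
-- Q-point containing the complement of every set in J, so the identity map
-- witnesses J ≤P U*.
--
-- The two parts of the theorem differ only in how lower bounds are found.
--
-- * Under CH the initial segments are countable, and a decreasing sequence of
--   finite intersections has a positive lower bound because J is a
--   P⁺(J)-ideal (countable⇒lower-bounds).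
--
-- * If J is the union of closed sets C n and 𝔭 = 𝔠, the pseudointersection is
--   taken on the countable set of finite subsets of ω (small⇒lower-bounds).  The
--   family consists, for each earlier stage A, of the collection of finite
--   subsets of A and, for each n, of the collection of finite sets not included
--   in any member of C n.  By compactness of the Cantor space, it has the strong
--   finite intersection property.  The union of an infinite pseudointersection
--   is almost included in each A and is in no C n, so it is positive.

open import Defs
open import Axiom.ExcludedMiddle using (ExcludedMiddle)
open import Axiom.Extensionality.Propositional using (Extensionality)
open import Axiom.UniquenessOfIdentityProofs.WithK using (uip)
open import Data.Bool.Base using (Bool; true; false; if_then_else_)
open import Data.Bool.Properties using (¬-not; ⇔→≡; not-involutive)
open import Data.Empty using (⊥-elim)
open import Data.Fin.Base using (Fin; toℕ; fromℕ<) renaming (zero to fzero; suc to fsuc)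
open import Data.Fin.Properties using (toℕ≤pred[n]; toℕ-fromℕ<; 0≢1+n) renaming (suc-injective to fsuc-injective; toℕ-injective to toℕ-injectiveᶠ)
open import Data.Fin.Subset using (Subset; ∣_∣)
open import Data.List.Base using (List; []; _∷_; map; concatMap; upTo; allFin)
open import Data.List.Membership.Propositional using (lose) renaming (_∈_ to _∈ˡ_)
open import Data.List.Membership.Propositional.Properties using (∈-upTo⁺; ∈-concatMap⁺; ∈-map⁺; ∈-allFin)
open import Data.List.Relation.Unary.All using (All; []; _∷_)
open import Data.List.Relation.Unary.Any using (here; there)
open import Data.Nat.Base using (ℕ; zero; suc; _≤_; _<_; z≤n; s≤s; _⊔_)
open import Data.Nat.Binary.Base using (ℕᵇ; zero; 2[1+_]; 1+[2_]) renaming (toℕ to ℕᵇ-toℕ; fromℕ to ℕᵇ-fromℕ)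
open import Data.Nat.Binary.Properties using (toℕ-injective; fromℕ-toℕ)
open import Data.Nat.Properties hiding (0≢1+n)
open import Data.Product using (∃; ∃!; _×_; _,_; proj₁; proj₂)
open import Data.Sum.Base using (_⊎_; inj₁; inj₂; [_,_]′)
open import Data.Unit.Base using (⊤; tt)
open import Data.Vec.Base using ([]; _∷_; lookup)
open import Data.Vec.Properties using (lookup∘tabulate)
open import Function.Base using (_∘_; id)
open import Function.Bundles using (_⇔_; _↣_; mk⇔; mk↣; module Equivalence; module Injection)
open import Function.Definitions using (Injective)
open import Induction.WellFounded using (Acc; acc; WellFounded; module All; module FixPoint)
open import Level using (0ℓ)
open import Relation.Binary.Construct.On using () renaming (wellFounded to on-wellFounded)
open import Relation.Binary.Definitions using (tri<; tri≈; tri>)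
open import Relation.Binary.PropositionalEquality.Core using (_≡_; _≢_; refl; sym; trans; cong; subst; _≗_)
open import Relation.Nullary.Decidable.Core using (yes; no; does; decidable-stable)
open import Relation.Nullary.Negation.Core using (¬_)

private
  variable
    X Y Z I : Set

-- Membership in the Boolean operations on characteristic functions

∩⁺ : ∀ (A B : 𝒫 X) {x} → x ∈ A → x ∈ B → x ∈ A ∩ B
∩⁺ A B {x} a b rewrite a = b

∩⁻ : ∀ (A B : 𝒫 X) {x} → x ∈ A ∩ B → x ∈ A × x ∈ B
∩⁻ A B {x} h with A x
... | true = refl , h

∪⁺ : ∀ (A B : 𝒫 X) {x} → x ∈ A ⊎ x ∈ B → x ∈ A ∪ B
∪⁺ A B {x} h with A x
∪⁺ A B (inj₁ ()) | false
∪⁺ A B (inj₂ b)  | false = b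
∪⁺ A B _         | true  = refl

∁⁺ : ∀ (A : 𝒫 X) {x} → ¬ x ∈ A → x ∈ ∁ A
∁⁺ A {x} h with A x
... | true  = ⊥-elim (h refl)
... | false = refl

∁⁻ : ∀ (A : 𝒫 X) {x} → x ∈ ∁ A → ¬ x ∈ A
∁⁻ A {x} h a with A x
∁⁻ A () refl | true

∖⁺ : ∀ (A B : 𝒫 X) {x} → x ∈ A → ¬ x ∈ B → x ∈ A ∖ B
∖⁺ A B a b = ∩⁺ A (∁ B) a (∁⁺ B b)

∖⁻ : ∀ (A B : 𝒫 X) {x} → x ∈ A ∖ B → x ∈ A × ¬ x ∈ B
∖⁻ A B h with a , b ← ∩⁻ A (∁ B) h = a , ∁⁻ B b

∈∪∁ : ∀ (A : 𝒫 X) x → x ∈ A ⊎ ¬ x ∈ A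
∈∪∁ A x with A x
... | true  = inj₁ refl
... | false = inj₂ λ ()

-- Injections

infixr 9 _∘↣_

_∘↣_ : Y ↣ Z → X ↣ Y → X ↣ Z
g ∘↣ f = mk↣ (Injection.injective f ∘ Injection.injective g)

Elem-≡ : ∀ {A : 𝒫 X} {a b : Elem A} → proj₁ a ≡ proj₁ b → a ≡ b
Elem-≡ {a = a , p} {_ , q} refl = cong (a ,_) (uip p q)

Elem↣ : (A : 𝒫 X) → Elem A ↣ X
Elem↣ A = mk↣ {to = proj₁} Elem-≡

-- Finite sets of natural numbers and finite-to-one functions

list-bounded : ∀ (xs : List ℕ) → ∃ λ N → ∀ {x} → x ∈ˡ xs → x < N
list-bounded []       = 0 , λ ()
list-bounded (y ∷ xs) with N , b ← list-bounded xs =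
  suc y ⊔ N , λ { (here refl) → m≤m⊔n (suc y) N
                ; (there x∈)  → ≤-trans (b x∈) (m≤n⊔m (suc y) N) }

finite⇒bounded : ∀ {A : 𝒫 ℕ} → Finite A → ∃ λ N → ∀ {x} → x ∈ A → x < N
finite⇒bounded (xs , h) with N , b ← list-bounded xs = N , b ∘ h

bounded⇒finite : ∀ {A : 𝒫 ℕ} N → (∀ {x} → x ∈ A → x < N) → Finite A
bounded⇒finite N b = upTo N , ∈-upTo⁺ ∘ b

finiteToOne-∘ : ∀ {f : Y → X} {g : Z → Y} →
                FiniteToOne f → FiniteToOne g → FiniteToOne (f ∘ g)
finiteToOne-∘ ff fg x with ys , h ← ff x =
  concatMap (λ y → proj₁ (fg y)) ys ,
  λ e → ∈-concatMap⁺ (λ y → proj₁ (fg y)) (lose (h e) (proj₂ (fg _) refl))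

≤KB-trans : {J : Family X} {K : Family Y} {L : Family Z} →
            J ≤KB K → K ≤KB L → J ≤KB L
≤KB-trans (f , ff , p) (g , fg , q) =
  f ∘ g , finiteToOne-∘ ff fg , λ B b → q (B ∘ f) (p B b)

preimage-bounded : ∀ {h : ℕ → ℕ} → FiniteToOne h →
                   ∀ n → ∃ λ N → ∀ {x} → h x < n → x < N
preimage-bounded ff zero    = 0 , λ ()
preimage-bounded ff (suc n)
  with N , b ← preimage-bounded ff n | M , c ← list-bounded (proj₁ (ff n)) =
  N ⊔ M , λ {x} lt → [ (λ l → ≤-trans (b l) (m≤m⊔n N M))
                     , (λ e → ≤-trans (c (proj₂ (ff n) e)) (m≤n⊔m N M))
                     ]′ (m<1+n⇒m<n∨m≡n lt)

increasing : ∀ (t : ℕ → ℕ) → (∀ n → t n < t (suc n)) → ∀ {m n} → m < n → t m < t n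
increasing t h {m} {suc n} m<1+n with m<1+n⇒m<n∨m≡n m<1+n
... | inj₁ m<n  = <-trans (increasing t h m<n) (h n)
... | inj₂ refl = h n

-- Codes: an injective pairing of ℕ and a coding of the finite subsets of ℕ

-- In the type ℕᵇ every list of digits 1 and 2 is a numeral, and distinct lists
-- denote distinct numbers.  The pair (n , x) is coded by n digits 1, followed by
-- x digits 2.

pairᵇ : ℕ → ℕ → ℕᵇ
pairᵇ (suc n) x       = 1+[2 pairᵇ n x ]
pairᵇ zero    (suc x) = 2[1+ pairᵇ zero x ]
pairᵇ zero    zero    = zero

1+[2]-injective : ∀ {a b} → 1+[2 a ] ≡ 1+[2 b ] → a ≡ b
1+[2]-injective refl = refl

2[1+]-injective : ∀ {a b} → 2[1+ a ] ≡ 2[1+ b ] → a ≡ b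
2[1+]-injective refl = refl

pairᵇ-injective : ∀ m x n y → pairᵇ m x ≡ pairᵇ n y → m ≡ n × x ≡ y
pairᵇ-injective (suc m) x (suc n) y e
  with pairᵇ-injective m x n y (1+[2]-injective e)
... | refl , refl = refl , refl
pairᵇ-injective zero (suc x) zero (suc y) e
  with pairᵇ-injective zero x zero y (2[1+]-injective e)
... | _ , refl = refl , refl
pairᵇ-injective zero zero zero zero _ = refl , refl
pairᵇ-injective (suc _) _       zero    zero    ()
pairᵇ-injective (suc _) _       zero    (suc _) ()
pairᵇ-injective zero    zero    (suc _) _       ()
pairᵇ-injective zero    (suc _) (suc _) _       ()

pair : ℕ → ℕ → ℕ
pair n x = ℕᵇ-toℕ (pairᵇ n x)

pair-injective : ∀ {m x n y} → pair m x ≡ pair n y → m ≡ n × x ≡ y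
pair-injective e = pairᵇ-injective _ _ _ _ (toℕ-injective e)

-- A numeral codes the set of positions of its digits 2.

digits : ℕᵇ → 𝒫 ℕ
digits zero     _       = false
digits 2[1+ b ] zero    = true
digits 1+[2 b ] zero    = false
digits 2[1+ b ] (suc k) = digits b k
digits 1+[2 b ] (suc k) = digits b k

-- The finite set coded by c.  Distinct codes may denote the same set.

decode : ℕ → 𝒫 ℕ
decode c = digits (ℕᵇ-fromℕ c)

digits-finite : ∀ b → ∃ λ N → ∀ {x} → x ∈ digits b → x < N
digits-finite zero     = 0 , λ ()
digits-finite 2[1+ b ] with N , h ← digits-finite b =
  suc N , λ { {zero} _ → s≤s z≤n ; {suc x} e → s≤s (h e) }
digits-finite 1+[2 b ] with N , h ← digits-finite b =
  suc N , λ { {zero} _ → s≤s z≤n ; {suc x} e → s≤s (h e) }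

-- A numeral with exactly m digits that codes the set of elements of A below m.

truncᵇ : 𝒫 ℕ → ℕ → ℕᵇ
truncᵇ A zero    = zero
truncᵇ A (suc m) = if A 0 then 2[1+ truncᵇ (A ∘ suc) m ] else 1+[2 truncᵇ (A ∘ suc) m ]

trunc : 𝒫 ℕ → ℕ → ℕ
trunc A m = ℕᵇ-toℕ (truncᵇ A m)

truncᵇ⊆ : ∀ A m → digits (truncᵇ A m) ⊆ A
truncᵇ⊆ A (suc m) {x} h with A 0 in e
truncᵇ⊆ A (suc m) {zero}  h | true  = e
truncᵇ⊆ A (suc m) {suc x} h | true  = truncᵇ⊆ (A ∘ suc) m h
truncᵇ⊆ A (suc m) {suc x} h | false = truncᵇ⊆ (A ∘ suc) m h

⊆truncᵇ : ∀ A m {x} → x < m → x ∈ A → x ∈ digits (truncᵇ A m)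
⊆truncᵇ A (suc m) {zero} _ h rewrite h = refl
⊆truncᵇ A (suc m) {suc x} (s≤s l) h with A 0
... | true  = ⊆truncᵇ (A ∘ suc) m l h
... | false = ⊆truncᵇ (A ∘ suc) m l h

decode-trunc : ∀ A m → decode (trunc A m) ≡ digits (truncᵇ A m)
decode-trunc A m = cong digits (fromℕ-toℕ (truncᵇ A m))

-- The codes of the truncations of A are therefore unbounded, even if A is finite.

m≤trunc : ∀ A m → m ≤ trunc A m
m≤trunc A zero    = z≤n
m≤trunc A (suc m) with A 0
... | true  = ≤-trans (s≤s (m≤trunc (A ∘ suc) m)) (m≤n*m _ 2)
... | false = s≤s (≤-trans (m≤trunc (A ∘ suc) m) (m≤n*m _ 2))

-- Finite sets as Boolean vectors

-- The number of elements of p that precede a given position.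

rank : ∀ {n} → Subset n → Fin n → ℕ
rank (_ ∷ p)     fzero    = 0
rank (true ∷ p)  (fsuc i) = suc (rank p i)
rank (false ∷ p) (fsuc i) = rank p i

rank<∣∣ : ∀ {n} (p : Subset n) i → lookup p i ≡ true → rank p i < ∣ p ∣
rank<∣∣ (true ∷ p)  fzero    _ = s≤s z≤n
rank<∣∣ (true ∷ p)  (fsuc i) h = s≤s (rank<∣∣ p i h)
rank<∣∣ (false ∷ p) (fsuc i) h = rank<∣∣ p i h

rank-injective : ∀ {n} (p : Subset n) i j → lookup p i ≡ true → lookup p j ≡ true →
                 rank p i ≡ rank p j → i ≡ j
rank-injective (b ∷ p)     fzero    fzero    _ _ _ = refl
rank-injective (true ∷ p)  fzero    (fsuc j) _ _ ()
rank-injective (true ∷ p)  (fsuc i) fzero    _ _ ()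
rank-injective (true ∷ p)  (fsuc i) (fsuc j) a b e = cong fsuc (rank-injective p i j a b (suc-injective e))
rank-injective (false ∷ p) (fsuc i) (fsuc j) a b e = cong fsuc (rank-injective p i j a b e)

no-element⇒∣∣≡0 : ∀ {n} (p : Subset n) → (∀ i → ¬ lookup p i ≡ true) → ∣ p ∣ ≡ 0
no-element⇒∣∣≡0 []          _ = refl
no-element⇒∣∣≡0 (true ∷ p)  h = ⊥-elim (h fzero refl)
no-element⇒∣∣≡0 (false ∷ p) h = no-element⇒∣∣≡0 p (h ∘ fsuc)

at-most-one⇒∣∣<2 : ∀ {n} (p : Subset n) →
                   (∀ i j → lookup p i ≡ true → lookup p j ≡ true → i ≡ j) → ∣ p ∣ < 2
at-most-one⇒∣∣<2 []          _ = s≤s z≤n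
at-most-one⇒∣∣<2 (true ∷ p)  h
  rewrite no-element⇒∣∣≡0 p (λ i e → 0≢1+n (h fzero (fsuc i) refl e)) = s≤s (s≤s z≤n)
at-most-one⇒∣∣<2 (false ∷ p) h =
  at-most-one⇒∣∣<2 p λ i j a b → fsuc-injective (h (fsuc i) (fsuc j) a b)

-- Excluded middle decides every type, so it also serves as a choice principle:
-- a type that is not empty yields an element (by-contra).

module Classical (em : ExcludedMiddle 0ℓ) (fe : Extensionality 0ℓ 0ℓ) where

  by-contra : {P : Set} → ¬ ¬ P → P
  by-contra = decidable-stable em

  -- The set of all x with P x, given by its characteristic function.

  setOf : (X → Set) → 𝒫 X
  setOf P x = does (em {P x})

  setOf⁺ : ∀ (P : X → Set) {x} → P x → x ∈ setOf P
  setOf⁺ P {x} p with em {P x}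
  ... | yes _ = refl
  ... | no ¬p = ⊥-elim (¬p p)

  setOf⁻ : ∀ (P : X → Set) {x} → x ∈ setOf P → P x
  setOf⁻ P {x} h with em {P x}
  ... | yes p = p
  setOf⁻ P {x} () | no _

  set-ext : ∀ {A B : 𝒫 X} → A ⊆ B → B ⊆ A → A ≡ B
  set-ext h k = fe λ x → ⇔→≡ (mk⇔ h k)

  injective⇒finiteToOne : ∀ {f : Y → X} → Injective _≡_ _≡_ f → FiniteToOne f
  injective⇒finiteToOne {f = f} inj x with em {∃ λ y → f y ≡ x}
  ... | yes (y , e) = y ∷ [] , λ e′ → here (inj (trans e′ (sym e)))
  ... | no ∄y       = [] , λ e → ⊥-elim (∄y (_ , e))

  -- Compactness of the Cantor space

  Unbounded : (ℕ → Set) → Set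
  Unbounded S = ∀ N → ∃ λ m → N ≤ m × S m

  unbounded-split : ∀ {S : ℕ → Set} (b : ℕ → Bool) → Unbounded S →
                    ¬ Unbounded (λ m → S m × b m ≡ true) →
                    Unbounded (λ m → S m × b m ≡ false)
  unbounded-split {S} b unb ¬tt N = by-contra λ ¬ff → ¬tt λ M →
    let m , N⊔M≤m , s = unb (N ⊔ M)
        N≤m = ≤-trans (m≤m⊔n N M) N⊔M≤m
        M≤m = ≤-trans (m≤n⊔m N M) N⊔M≤m
    in m , M≤m , s , ¬-not λ bm≡false → ¬ff (m , N≤m , s , bm≡false)

  -- Bit n of the limit is a value that B m takes at n for unboundedly many of the
  -- indices m for which B m agrees with the limit below n; Agreeing n is the set
  -- of these indices.

  module Limit (B : ℕ → 𝒫 ℕ) where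

    mutual
      Agreeing : ℕ → ℕ → Set
      Agreeing zero    m = ⊤
      Agreeing (suc n) m = Agreeing n m × B m n ≡ limit n

      limit : 𝒫 ℕ
      limit n = does (em {Unbounded λ m → Agreeing n m × B m n ≡ true})

    agreeing-unbounded : ∀ n → Unbounded (Agreeing n)
    agreeing-unbounded zero    N = N , ≤-refl , tt
    agreeing-unbounded (suc n) with em {Unbounded λ m → Agreeing n m × B m n ≡ true}
    ... | yes unb = unb
    ... | no ¬unb = unbounded-split (λ m → B m n) (agreeing-unbounded n) ¬unb

    agrees : ∀ n {m} → Agreeing n m → ∀ i → i < n → limit i ≡ B m i
    agrees (suc n) (a , e) i i<1+n with m<1+n⇒m<n∨m≡n i<1+n
    ... | inj₁ i<n  = agrees n a i i<n
    ... | inj₂ refl = sym e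

  -- If every finite part of A is included in a member of the closed set K, then so
  -- is A.

  compactness : ∀ {K : Family ℕ} → Closed K → ∀ {A} →
                (∀ m → ∃ λ B → K B × (∀ {x} → x < m → x ∈ A → x ∈ B)) →
                ∃ λ B → K B × A ⊆ B
  compactness {K} closed {A} approx = limit , by-contra ¬¬K , A⊆limit
    where
    open Limit (proj₁ ∘ approx)

    ¬¬K : ¬ ¬ K limit
    ¬¬K ¬K with n , far ← closed limit ¬K
      with m , _ , a ← agreeing-unbounded n 0 =
      far (proj₁ (approx m)) (agrees n a) (proj₁ (proj₂ (approx m)))

    A⊆limit : A ⊆ limit
    A⊆limit {x} x∈A with m , x<m , a ← agreeing-unbounded (suc x) (suc x) =
      trans (agrees (suc x) a x ≤-refl) (proj₂ (proj₂ (approx m)) x<m x∈A)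

  -- Injections of 𝒫 ℕ

  cantor : ¬ (𝒫 ℕ ↣ ℕ)
  cantor inj = D∌D D∈D
    where
    open Injection inj renaming (to to h)
    Diagonal : ℕ → Set
    Diagonal n = ∃ λ A → h A ≡ n × ¬ n ∈ A
    D : 𝒫 ℕ
    D = setOf Diagonal
    D∌D : ¬ h D ∈ D
    D∌D d with A , e , ∉A ← setOf⁻ Diagonal d rewrite injective e = ∉A d
    D∈D : h D ∈ D
    D∈D = setOf⁺ Diagonal (D , refl , D∌D)

  interleave : 𝒫 ℕ → 𝒫 ℕ → 𝒫 ℕ
  interleave A B zero    = A 0
  interleave A B (suc n) = interleave B (A ∘ suc) n

  interleave-≗ : ∀ {A B A′ B′} → interleave A B ≗ interleave A′ B′ →
                 ∀ n → A n ≡ A′ n × B n ≡ B′ n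
  interleave-≗ e zero    = e 0 , e 1
  interleave-≗ e (suc n) = interleave-≗ (e ∘ suc ∘ suc) n

  interleave-injective : ∀ {A B A′ B′} → interleave A B ≡ interleave A′ B′ → A ≡ A′ × B ≡ B′
  interleave-injective e =
    let e′ = interleave-≗ (λ n → cong (λ f → f n) e)
    in fe (proj₁ ∘ e′) , fe (proj₂ ∘ e′)

  -- Composing with interleave gives an injection of 𝒫 ℕ × 𝒫 ℕ into I ⊎ ℕ.  Either
  -- it maps some row into I, or choosing in every row a point that is mapped into
  -- ℕ gives an injection of 𝒫 ℕ into ℕ.

  absorb-ℕ : 𝒫 ℕ ↣ (I ⊎ ℕ) → 𝒫 ℕ ↣ I
  absorb-ℕ {I} inj with em {∃ λ A → ∀ B → ∃ λ i → Injection.to inj (interleave A B) ≡ inj₁ i}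
  ... | yes (A , row) = mk↣ {to = proj₁ ∘ row} λ {B} {B′} e →
    proj₂ (interleave-injective (Injection.injective inj
      (trans (proj₂ (row B)) (trans (cong inj₁ e) (sym (proj₂ (row B′)))))))
  ... | no ∄row = ⊥-elim (cantor (mk↣ {to = proj₁ ∘ proj₂ ∘ point} λ {A} {A′} e →
    proj₁ (interleave-injective (Injection.injective inj
      (trans (proj₂ (proj₂ (point A))) (trans (cong inj₂ e) (sym (proj₂ (proj₂ (point A′))))))))))
    where
    point : ∀ A → ∃ λ B → ∃ λ n → Injection.to inj (interleave A B) ≡ inj₂ n
    point A = by-contra λ ∄point → ∄row (A , λ B → in-I B ∄point)
      where
      in-I : ∀ B → ¬ (∃ λ B → ∃ λ n → Injection.to inj (interleave A B) ≡ inj₂ n) →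
             ∃ λ i → Injection.to inj (interleave A B) ≡ inj₁ i
      in-I B ∄point with Injection.to inj (interleave A B) in e
      ... | inj₁ i = i , refl
      ... | inj₂ n = ⊥-elim (∄point (B , n , e))

  ⊎ℕ↣𝒫ℕ : I ↣ 𝒫 ℕ → (I ⊎ ℕ) ↣ 𝒫 ℕ
  ⊎ℕ↣𝒫ℕ {I} inj = mk↣ {to = φ} φ-injective
    where
    φ : I ⊎ ℕ → 𝒫 ℕ
    φ (inj₁ i) = λ { zero → true  ; (suc k) → Injection.to inj i k }
    φ (inj₂ n) = λ { zero → false ; (suc k) → setOf (_≡ n) k }
    φ-injective : Injective _≡_ _≡_ φ
    φ-injective {inj₁ i} {inj₁ j} e = cong inj₁ (Injection.injective inj (cong (λ f → f ∘ suc) e))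
    φ-injective {inj₁ i} {inj₂ n} e with () ← cong (λ f → f 0) e
    φ-injective {inj₂ m} {inj₁ j} e with () ← cong (λ f → f 0) e
    φ-injective {inj₂ m} {inj₂ n} e = cong inj₂ (setOf⁻ (_≡ n)
      (trans (sym (cong (λ f → f (suc m)) e)) (setOf⁺ (_≡ m) refl)))

  -- Zermelo's well-ordering theorem

  -- An order is given by its initial segments: x ∈ below y means that x
  -- precedes y.  Transitivity follows from the two properties.

  record IsWellOrder (below : X → 𝒫 X) : Set where
    field
      wellFounded : WellFounded (λ x y → x ∈ below y)
      connected   : ∀ x y → x ∈ below y ⊎ x ≡ y ⊎ y ∈ below x

  module Zermelo {X : Set} (x₀ : X) where

    -- Chooses an element outside S, if there is one.

    ε : 𝒫 X → X
    ε S with em {∃ λ x → ¬ x ∈ S}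
    ... | yes (x , _) = x
    ... | no _        = x₀

    ε∈⇒full : ∀ S → ε S ∈ S → ∀ x → x ∈ S
    ε∈⇒full S h x with em {∃ λ x → ¬ x ∈ S}
    ... | yes (_ , y∉S) = ⊥-elim (y∉S h)
    ... | no full-S     = by-contra λ x∉S → full-S (x , x∉S)

    -- Adds to S the element chosen by ε.

    step-pred : 𝒫 X → X → Set
    step-pred S x = x ∈ S ⊎ x ≡ ε S

    step : 𝒫 X → 𝒫 X
    step S = setOf (step-pred S)

    ⋃-pred : 𝒫 (𝒫 X) → X → Set
    ⋃-pred F x = ∃ λ S → S ∈ F × x ∈ S

    ⋃ : 𝒫 (𝒫 X) → 𝒫 X
    ⋃ F = setOf (⋃-pred F)

    -- The stages of the transfinite enumeration of X by ε: the least family of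
    -- sets closed under step and under arbitrary unions.

    data Stage : 𝒫 X → Set where
      next : ∀ {S} → Stage S → Stage (step S)
      sup  : ∀ F → (∀ S → S ∈ F → Stage S) → Stage (⋃ F)

    ⊆step : ∀ S → S ⊆ step S
    ⊆step S x∈S = setOf⁺ (step-pred S) (inj₁ x∈S)

    ε∈step : ∀ S → ε S ∈ step S
    ε∈step S = setOf⁺ (step-pred S) (inj₂ refl)

    -- T is extreme if no step jumps over T from a stage strictly below it.

    Extreme : 𝒫 X → Set
    Extreme T = ∀ {S} → Stage S → S ⊆ T → ¬ (T ⊆ S) → step S ⊆ T

    extreme⇒comparable : ∀ {T} → Extreme T → ∀ {S} → Stage S → S ⊆ T ⊎ step T ⊆ S
    extreme⇒comparable {T} ext (next {S} s) with extreme⇒comparable ext s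
    ... | inj₂ h = inj₂ (⊆step S ∘ h)
    ... | inj₁ S⊆T with em {T ⊆ S}
    ...   | no T⊈S = inj₁ (ext s S⊆T T⊈S)
    ...   | yes T⊆S with refl ← set-ext {A = S} {B = T} S⊆T T⊆S = inj₂ id
    extreme⇒comparable {T} ext (sup F stages) with em {∃ λ S → S ∈ F × step T ⊆ S}
    ... | yes (S , S∈F , h) = inj₂ λ x∈ → setOf⁺ (⋃-pred F) (S , S∈F , h x∈)
    ... | no ∄S = inj₁ ⋃F⊆T
      where
      ⋃F⊆T : ⋃ F ⊆ T
      ⋃F⊆T x∈ with S , S∈F , x∈S ← setOf⁻ (⋃-pred F) x∈
        with extreme⇒comparable ext (stages S S∈F)
      ... | inj₁ S⊆T = S⊆T x∈S
      ... | inj₂ h   = ⊥-elim (∄S (S , S∈F , h))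

    extreme : ∀ {T} → Stage T → Extreme T
    extreme (next {T} t) {S} s S⊆stepT stepT⊈S with extreme⇒comparable (extreme t) s
    ... | inj₂ h = ⊥-elim (stepT⊈S h)
    ... | inj₁ S⊆T with em {T ⊆ S}
    ...   | no T⊈S = λ x∈ → ⊆step T (extreme t s S⊆T T⊈S x∈)
    ...   | yes T⊆S with refl ← set-ext {A = S} {B = T} S⊆T T⊆S = id
    extreme (sup F stages) {S} s S⊆⋃ ⋃⊈S with em {∃ λ T → T ∈ F × ¬ (T ⊆ S)}
    ... | no ∄T = ⊥-elim (⋃⊈S λ x∈ →
      let T , T∈F , x∈T = setOf⁻ (⋃-pred F) x∈
      in by-contra λ x∉S → ∄T (T , T∈F , λ T⊆S → x∉S (T⊆S x∈T)))
    ... | yes (T , T∈F , T⊈S) with extreme⇒comparable (extreme (stages T T∈F)) s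
    ...   | inj₂ h   = ⊥-elim (T⊈S (λ x∈ → h (⊆step T x∈)))
    ...   | inj₁ S⊆T = λ x∈ →
      setOf⁺ (⋃-pred F) (T , T∈F , extreme (stages T T∈F) s S⊆T T⊈S x∈)

    comparable : ∀ {S T} → Stage S → Stage T → S ⊆ T ⊎ step T ⊆ S
    comparable s t = extreme⇒comparable (extreme t) s

    -- precedes y x means that x is enumerated before y.

    precedes : X → X → Set
    precedes y x = ∃ λ S → Stage S × x ∈ S × ¬ y ∈ S

    below : X → 𝒫 X
    below y = setOf (precedes y)

    _≺′_ : X → X → Set
    x ≺′ y = x ∈ below y

    stage-accessible : ∀ {S} → Stage S → ∀ {x} → x ∈ S → Acc _≺′_ x
    stage-accessible (sup F stages) x∈ with S , S∈F , x∈S ← setOf⁻ (⋃-pred F) x∈ =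
      stage-accessible (stages S S∈F) x∈S
    stage-accessible (next {S} s) x∈ with setOf⁻ (step-pred S) x∈
    ... | inj₁ x∈S  = stage-accessible s x∈S
    ... | inj₂ refl = acc below-ε
      where
      below-ε : ∀ {y} → y ≺′ ε S → Acc _≺′_ y
      below-ε y<ε with T , t , y∈T , ε∉T ← setOf⁻ (precedes (ε S)) y<ε
        with comparable t s
      ... | inj₁ T⊆S = stage-accessible s (T⊆S y∈T)
      ... | inj₂ h   = ⊥-elim (ε∉T (h (ε∈step S)))

    largest : 𝒫 X
    largest = ⋃ (setOf Stage)

    largest-stage : Stage largest
    largest-stage = sup (setOf Stage) λ _ → setOf⁻ Stage

    stage⊆largest : ∀ {S} → Stage S → S ⊆ largest
    stage⊆largest {S} s x∈S = setOf⁺ (⋃-pred _) (S , setOf⁺ Stage s , x∈S)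

    largest-full : ∀ x → x ∈ largest
    largest-full = ε∈⇒full largest (stage⊆largest (next largest-stage) (ε∈step largest))


    avoids : X → 𝒫 X → Set
    avoids x S = Stage S × ¬ x ∈ S

    -- The largest stage that does not contain x; the next step adds x.

    before : X → 𝒫 X
    before x = ⋃ (setOf (avoids x))

    before-stage : ∀ x → Stage (before x)
    before-stage x = sup _ λ S → proj₁ ∘ setOf⁻ (avoids x)

    ∉before : ∀ x → ¬ x ∈ before x
    ∉before x x∈ with S , S∈ , x∈S ← setOf⁻ (⋃-pred _) x∈ = proj₂ (setOf⁻ (avoids x) S∈) x∈S

    ε-before : ∀ x → x ≡ ε (before x)
    ε-before x = by-contra λ x≢ε →
      let x∉step : ¬ x ∈ step (before x)
          x∉step = λ x∈ → [ ∉before x , x≢ε ]′ (setOf⁻ (step-pred (before x)) x∈)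
          ε∈     = setOf⁺ (⋃-pred _)
                     (step (before x) , setOf⁺ (avoids x) (next (before-stage x) , x∉step) , ε∈step (before x))
      in ∉before x (ε∈⇒full (before x) ε∈ x)

    isWellOrder : IsWellOrder below
    isWellOrder = record
      { wellFounded = λ x → stage-accessible largest-stage (largest-full x)
      ; connected   = connected
      }
      where
      connected : ∀ x y → x ≺′ y ⊎ x ≡ y ⊎ y ≺′ x
      connected x y with ∈∪∁ (before x) y | ∈∪∁ (step (before x)) y
      ... | inj₁ y∈ | _ = inj₂ (inj₂ (setOf⁺ (precedes x) (before x , before-stage x , y∈ , ∉before x)))
      ... | inj₂ _  | inj₂ y∉ =
        inj₁ (setOf⁺ (precedes y) (step (before x) , next (before-stage x)
             , subst (_∈ step (before x)) (sym (ε-before x)) (ε∈step (before x)) , y∉))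
      ... | inj₂ y∉ | inj₁ y∈ with setOf⁻ (step-pred (before x)) y∈
      ...   | inj₁ y∈b = ⊥-elim (y∉ y∈b)
      ...   | inj₂ y≡ε = inj₂ (inj₁ (trans (ε-before x) (sym y≡ε)))

  -- Every proper initial segment has size less than continuum.

  HasSmallSegments : (𝒫 ℕ → 𝒫 (𝒫 ℕ)) → Set
  HasSmallSegments below = ∀ y → ¬ (𝒫 ℕ ↣ Elem (below y))

  -- If the order given by Zermelo's theorem has a segment of size continuum, the
  -- order of the least such segment is pulled back along an injection of 𝒫 ℕ.

  initial-well-order : ∃ λ below → IsWellOrder below × HasSmallSegments below
  initial-well-order with em {HasSmallSegments (Zermelo.below ∅)}
  ... | yes small = Zermelo.below ∅ , Zermelo.isWellOrder ∅ , small
  ... | no ¬small = below , record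
    { wellFounded = on-wellFounded e wellFounded
    ; connected   = λ x y →
        [ inj₁ , [ inj₂ ∘ inj₁ ∘ e-injective , inj₂ ∘ inj₂ ]′ ]′ (connected (e x) (e y))
    } , λ y inj → proj₂ (proj₂ least) _ (proj₂ (Injection.to (proj₁ (proj₂ least)) y)) (segment y ∘↣ inj)
    where
    open Zermelo {X = 𝒫 ℕ} ∅ using () renaming (below to below₀; isWellOrder to isWellOrder₀)
    open IsWellOrder isWellOrder₀
    Big : 𝒫 ℕ → Set
    Big y = 𝒫 ℕ ↣ Elem (below₀ y)
    least : ∃ λ x → Big x × (∀ y → y ∈ below₀ x → ¬ Big y)
    least = by-contra λ ∄least →
      ¬small (All.wfRec wellFounded 0ℓ (λ y → ¬ Big y) λ y ih big → ∄least (y , big , λ z → ih {z}))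
    e : 𝒫 ℕ → 𝒫 ℕ
    e = proj₁ ∘ Injection.to (proj₁ (proj₂ least))
    e-injective : Injective _≡_ _≡_ e
    e-injective p = Injection.injective (proj₁ (proj₂ least)) (Elem-≡ p)
    below : 𝒫 ℕ → 𝒫 (𝒫 ℕ)
    below y = below₀ (e y) ∘ e
    segment : ∀ y → Elem (below y) ↣ Elem (below₀ (e y))
    segment y = mk↣ {to = λ (u , u<y) → e u , u<y} λ p → Elem-≡ (e-injective (cong proj₁ p))

  -- Ideals on ℕ and lower bounds modulo an ideal

  module Ideal {J : Family ℕ} (isIdeal : IsIdeal J) where
    open IsIdeal isIdeal

    -- Closure under unions and subsets in one step.

    ∪-cover : ∀ {A B C} → (∀ {x} → x ∈ C → x ∈ A ⊎ x ∈ B) → J A → J B → J C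
    ∪-cover {A} {B} h a b = ⊆-closed (λ x∈ → ∪⁺ A B (h x∈)) (∪-closed a b)

    ∅∈J : ∀ {A} → (∀ {x} → ¬ x ∈ A) → J A
    ∅∈J empty = finite ([] , λ x∈ → ⊥-elim (empty x∈))

    ∖-mono : ∀ {B C} A → C ⊆ B → J (B ∖ A) → J (C ∖ A)
    ∖-mono {B} {C} A C⊆B = ⊆-closed λ x∈ →
      let x∈C , x∉A = ∖⁻ C A x∈ in ∖⁺ B A (C⊆B x∈C) x∉A

    ∖-trans : ∀ A B C → J (A ∖ B) → J (B ∖ C) → J (A ∖ C)
    ∖-trans A B C = ∪-cover λ {x} x∈ → let x∈A , x∉C = ∖⁻ A C x∈ in
      [ (λ x∈B → inj₂ (∖⁺ B C x∈B x∉C)) , (λ x∉B → inj₁ (∖⁺ A B x∈A x∉B)) ]′ (∈∪∁ B x)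

    positive-⊆ : ∀ {A B} → (J ⁺) A → J (A ∖ B) → (J ⁺) B
    positive-⊆ {A} {B} a a∖b b = a (∪-cover (λ {x} x∈A →
      [ inj₂ , (λ x∉B → inj₁ (∖⁺ A B x∈A x∉B)) ]′ (∈∪∁ B x)) a∖b b)

    -- All finite intersections are positive; the empty one is the whole of ℕ.

    Centered : (I → 𝒫 ℕ) → Set
    Centered g = ∀ is → (J ⁺) (⋂ (map g is))

    -- Every centered family indexed by I has a positive lower bound modulo J.

    HasLowerBounds : Set → Set
    HasLowerBounds I =
      ∀ (g : I → 𝒫 ℕ) → Centered g → ∃ λ B → (J ⁺) B × (∀ i → J (B ∖ g i))

    chain⇒centered : ∀ (g : I → 𝒫 ℕ) → (∀ i → (J ⁺) (g i)) →
                     (∀ i j → J (g i ∖ g j) ⊎ J (g j ∖ g i)) → Centered g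
    chain⇒centered g positive chain []       = proper
    chain⇒centered g positive chain (i ∷ is) =
      let j , j-least = least is in positive-⊆ (positive j) j-least
      where
      -- Modulo J, a nonempty finite subfamily has a least member.
      least : ∀ js → ∃ λ j → J (g j ∖ ⋂ (map g (i ∷ js)))
      least [] = i , ∅∈J λ x∈ →
        let x∈A , x∉ = ∖⁻ (g i) (g i ∩ full) x∈ in x∉ (∩⁺ (g i) full x∈A refl)
      least (k ∷ js) with j , j-least ← least js = [ j≤k , k≤j ]′ (chain j k)
        where
        rest = ⋂ (map g js)
        below-all : ∀ l → J (g l ∖ g k) → J (g l ∖ (g i ∩ rest)) →
                    J (g l ∖ (g i ∩ (g k ∩ rest)))
        below-all l = ∪-cover λ {x} x∈ →
          let x∈l , x∉ = ∖⁻ (g l) (g i ∩ (g k ∩ rest)) x∈ in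
          [ (λ x∈k → inj₂ (∖⁺ (g l) (g i ∩ rest) x∈l λ x∈ir →
              let x∈i , x∈r = ∩⁻ (g i) rest x∈ir
              in x∉ (∩⁺ (g i) (g k ∩ rest) x∈i (∩⁺ (g k) rest x∈k x∈r))))
          , (λ x∉k → inj₁ (∖⁺ (g l) (g k) x∈l x∉k)) ]′ (∈∪∁ (g k) x)
        j≤k : J (g j ∖ g k) → ∃ λ l → J (g l ∖ (g i ∩ (g k ∩ rest)))
        j≤k p = j , below-all j p j-least
        k≤j : J (g k ∖ g j) → ∃ λ l → J (g l ∖ (g i ∩ (g k ∩ rest)))
        k≤j p = k , below-all k
          (∅∈J λ x∈ → let x∈k , x∉k = ∖⁻ (g k) (g k) x∈ in x∉k x∈k)
          (∖-trans (g k) (g j) (g i ∩ rest) p j-least)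

    -- The P⁺ property is applied to the sequence whose nth term intersects the
    -- members with number below n.

    countable⇒lower-bounds : IsP⁺ J → I ↣ ℕ → HasLowerBounds I
    countable⇒lower-bounds {I} p⁺ inj g centered =
      let B , positive , below = p⁺ A decreasing (centered ∘ indices)
      in B , positive , λ i → ⊆-closed (λ x∈ →
           let x∈B , x∉ = ∖⁻ B (g i) x∈
           in ∖⁺ B (A (suc (h i))) x∈B (x∉ ∘ A⊆g i)) (below (suc (h i)))
      where
      open Injection inj renaming (to to h)
      indices : ℕ → List I
      indices zero    = []
      indices (suc n) with em {∃ λ i → h i ≡ n}
      ... | yes (i , _) = i ∷ indices n
      ... | no _        = indices n
      A : ℕ → 𝒫 ℕ
      A n = ⋂ (map g (indices n))
      decreasing : ∀ n → A (suc n) ⊆ A n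
      decreasing n x∈ with em {∃ λ i → h i ≡ n}
      ... | yes (i , _) = proj₂ (∩⁻ (g i) (A n) x∈)
      ... | no _        = x∈
      A⊆g : ∀ i → A (suc (h i)) ⊆ g i
      A⊆g i x∈ with em {∃ λ j → h j ≡ h i}
      ... | no ∄j       = ⊥-elim (∄j (i , refl))
      ... | yes (j , e) with refl ← injective e = proj₁ (∩⁻ (g i) (A (h i)) x∈)

    -- An Fσ ideal and families of fewer than 𝔭 sets

    module _ {C : ℕ → Family ℕ} (closed : ∀ n → Closed (C n))
             (J⇔C : ∀ A → J A ⇔ ∃ λ n → C n A) where

      -- The finite set coded by c is not included in any member of C n.

      Escapes : ℕ → ℕ → Set
      Escapes n c = ¬ (∃ λ B → C n B × decode c ⊆ B)

      trunc-escapes : ∀ {A} → (J ⁺) A → ∀ n → ∃ λ m₀ → ∀ m → m₀ ≤ m → Escapes n (trunc A m)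
      trunc-escapes {A} positive n = by-contra λ none →
        let B , B∈C , A⊆B = compactness (closed n) (approximate none)
        in positive (⊆-closed A⊆B (Equivalence.from (J⇔C B) (n , B∈C)))
        where
        approximate : ¬ (∃ λ m₀ → ∀ m → m₀ ≤ m → Escapes n (trunc A m)) →
                      ∀ m → ∃ λ B → C n B × (∀ {x} → x < m → x ∈ A → x ∈ B)
        approximate none m = by-contra λ ∄B → none (m , λ k m≤k (B , B∈C , trunc⊆B) →
          ∄B (B , B∈C , λ {x} x<m x∈A → trunc⊆B
            (subst (x ∈_) (sym (decode-trunc A k)) (⊆truncᵇ A k (≤-trans x<m m≤k) x∈A))))

      module _ (g : I → 𝒫 ℕ) (centered : Centered g) where

        -- The conditions on codes of finite sets: to be included in g i, or to escape
        -- from C n.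

        Condition : I ⊎ ℕ → ℕ → Set
        Condition (inj₁ i) c = ∀ x → x ∈ decode c → x ∈ g i
        Condition (inj₂ n) c = Escapes n c

        InFamily : 𝒫 ℕ → Set
        InFamily A = ∃ λ k → A ≡ setOf (Condition k)

        𝓕 : 𝒫 (𝒫 ℕ)
        𝓕 = setOf InFamily

        condition∈𝓕 : ∀ k → setOf (Condition k) ∈ 𝓕
        condition∈𝓕 k = setOf⁺ InFamily (k , refl)

        𝓕↣ : Elem 𝓕 ↣ (I ⊎ ℕ)
        𝓕↣ = mk↣ {to = λ (_ , A∈) → proj₁ (setOf⁻ InFamily A∈)} λ {(_ , A∈)} {(_ , B∈)} e →
          Elem-≡ (trans (proj₂ (setOf⁻ InFamily A∈))
                 (trans (cong (setOf ∘ Condition) e) (sym (proj₂ (setOf⁻ InFamily B∈)))))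

        -- Finitely many members of the family involve only finitely many of the sets
        -- g i; they contain almost all truncations of any positive set included in the
        -- intersection of these.

        eventually-in : ∀ As → All (_∈ 𝓕) As → ∃ λ is → ∀ G → (J ⁺) G → G ⊆ ⋂ (map g is) →
                        ∃ λ m₀ → ∀ m → m₀ ≤ m → trunc G m ∈ ⋂ As
        eventually-in []       []         = [] , λ _ _ _ → 0 , λ _ _ → refl
        eventually-in (A ∷ As) (A∈ ∷ As∈) with eventually-in As As∈ | setOf⁻ InFamily A∈
        ... | is , h | inj₁ i , refl = i ∷ is , λ G positive G⊆ →
          let m₀ , late = h G positive (λ x∈ → proj₂ (∩⁻ (g i) (⋂ (map g is)) (G⊆ x∈)))
          in m₀ , λ m m₀≤m → ∩⁺ (setOf (Condition (inj₁ i))) (⋂ As)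
               (setOf⁺ (Condition (inj₁ i)) {trunc G m} λ x x∈ → proj₁ (∩⁻ (g i) (⋂ (map g is)) (G⊆
                 (truncᵇ⊆ G m (subst (x ∈_) (decode-trunc G m) x∈)))))
               (late m m₀≤m)
        ... | is , h | inj₂ n , refl = is , λ G positive G⊆ →
          let m₀ , late = h G positive G⊆
              m₁ , esc  = trunc-escapes positive n
          in m₀ ⊔ m₁ , λ m ≤m → ∩⁺ (setOf (Condition (inj₂ n))) (⋂ As)
               (setOf⁺ (Condition (inj₂ n)) {trunc G m} (esc m (≤-trans (m≤n⊔m m₀ m₁) ≤m)))
               (late m (≤-trans (m≤m⊔n m₀ m₁) ≤m))

        strongFIP : StrongFIP 𝓕
        strongFIP As As∈ fin =
          let is , h     = eventually-in As As∈
              G          = ⋂ (map g is)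
              m₀ , late  = h G (centered is) id
              N , bound  = finite⇒bounded fin
          in <-irrefl refl (≤-trans (bound (late (m₀ ⊔ N) (m≤m⊔n m₀ N)))
               (≤-trans (m≤n⊔m m₀ N) (m≤trunc G (m₀ ⊔ N))))

        module _ {P : 𝒫 ℕ} (isPseudo : IsPseudointersection P 𝓕) where

          almost : ∀ k → Finite (P ∖ setOf (Condition k))
          almost k = proj₂ isPseudo _ (condition∈𝓕 k)

          -- The union of the finite sets coded by the elements of P.

          InUnion : ℕ → Set
          InUnion x = ∃ λ c → c ∈ P × x ∈ decode c

          union : 𝒫 ℕ
          union = setOf InUnion

          union-positive : (J ⁺) union
          union-positive u with n , u∈C ← Equivalence.to (J⇔C union) u
            with xs , covers ← almost (inj₂ n) = proj₁ isPseudo (xs , λ {c} c∈P →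
              covers (∖⁺ P (setOf (Condition (inj₂ n))) c∈P λ c∈ →
                setOf⁻ (Condition (inj₂ n)) {c} c∈
                  (union , u∈C , λ x∈ → setOf⁺ InUnion (c , c∈P , x∈))))

          decode-bounded : ∀ N → ∃ λ M → ∀ {c x} → c < N → x ∈ decode c → x < M
          decode-bounded zero    = 0 , λ ()
          decode-bounded (suc N)
            with M , h ← decode-bounded N | K , k ← digits-finite (ℕᵇ-fromℕ N) =
            M ⊔ K , λ {c} {x} c<1+N x∈ → [ (λ c<N → ≤-trans (h {c} c<N x∈) (m≤m⊔n M K))
              , (λ c≡N → ≤-trans (k (subst (λ c → x ∈ decode c) c≡N x∈)) (m≤n⊔m M K))
              ]′ (m<1+n⇒m<n∨m≡n c<1+N)

          union-below : ∀ i → J (union ∖ g i)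
          union-below i with N , bound ← finite⇒bounded (almost (inj₁ i))
            with M , h ← decode-bounded N = finite (bounded⇒finite M λ {x} x∈ →
              let x∈u , x∉g = ∖⁻ union (g i) x∈
                  c , c∈P , x∈c = setOf⁻ InUnion x∈u
              in h {c} (bound (∖⁺ P (setOf (Condition (inj₁ i))) c∈P λ c∈ →
                     x∉g (setOf⁻ (Condition (inj₁ i)) {c} c∈ x x∈c))) x∈c)

    -- If I does not have size continuum or more, then neither does I ⊎ ℕ, and so
    -- neither does the family 𝓕.

    small⇒lower-bounds : Fσ J → 𝔭≡𝔠 → ¬ (𝒫 ℕ ↣ I) → HasLowerBounds I
    small⇒lower-bounds (C , closed , J⇔C) (_ , 𝔠≤) small g centered
      with em {∃ λ P → IsPseudointersection P (𝓕 closed J⇔C g centered)}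
    ... | yes (P , isPseudo) = union closed J⇔C g centered isPseudo
                             , union-positive closed J⇔C g centered isPseudo
                             , union-below closed J⇔C g centered isPseudo
    ... | no none = ⊥-elim (small (absorb-ℕ (𝓕↣ closed J⇔C g centered ∘↣
            𝔠≤ (𝓕 closed J⇔C g centered) (strongFIP closed J⇔C g centered , none))))

  -- CH is applied to I ⊎ ℕ, which is infinite and smaller than the continuum.

  CH⇒countable : CH → I ↣ 𝒫 ℕ → ¬ (𝒫 ℕ ↣ I) → I ↣ ℕ
  CH⇒countable {I} ch inj small = by-contra λ uncountable → ch ((I ⊎ ℕ) ,
    (mk↣ {to = inj₂} (λ { refl → refl }) , λ c → uncountable (c ∘↣ mk↣ {to = inj₁} λ { refl → refl })) ,
    (⊎ℕ↣𝒫ℕ inj , small ∘ absorb-ℕ))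

  -- Q-points and EDFin

  -- The entries of the vector column A n, as a function of the position.

  entry : 𝒫 Δ → (n : ℕ) → Fin (suc n) → Bool
  entry A n k = A ((n , toℕ k) , toℕ≤pred[n] k)

  -- A set with at most one point in each column is in EDFin.

  thin⇒EDFin : ∀ A → (∀ {d e} → d ∈ A → e ∈ A → proj₁ (proj₁ d) ≡ proj₁ (proj₁ e) → d ≡ e) →
               EDFin A
  thin⇒EDFin A thin = 2 , λ n → at-most-one⇒∣∣<2 (column A n) λ i j a b →
    toℕ-injectiveᶠ (cong (proj₂ ∘ proj₁) (thin
      (trans (sym (lookup∘tabulate (entry A n) i)) a)
      (trans (sym (lookup∘tabulate (entry A n) j)) b) refl))

  columnIndex-finiteToOne : FiniteToOne {Y = Δ} (λ d → proj₁ (proj₁ d))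
  columnIndex-finiteToOne n = map point (allFin (suc n)) , λ { {(_ , k) , k≤n} refl →
    subst (_∈ˡ map point (allFin (suc n))) (point-≡ k≤n (toℕ-fromℕ< (s≤s k≤n)))
      (∈-map⁺ point (∈-allFin (fromℕ< (s≤s k≤n)))) }
    where
    point : Fin (suc n) → Δ
    point i = (n , toℕ i) , toℕ≤pred[n] i
    point-≡ : ∀ {i k} (k≤n : k ≤ n) → toℕ i ≡ k → point i ≡ ((n , k) , k≤n)
    point-≡ {i} k≤n refl = cong ((n , toℕ i) ,_) (≤-irrelevant _ k≤n)

  module QPoint {U : Family ℕ} (isQPoint : IsQPoint U) where
    open IsQPoint isQPoint
    open IsUltrafilter isUltrafilter

    -- The fibres of h are grouped into the blocks t k ≤ h x < t (suc k), with
    -- thresholds t chosen so that no block is empty.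

    injective-on-large-set : ∀ {h : ℕ → ℕ} → FiniteToOne h →
      ∃ λ A → U A × (∀ {x y} → x ∈ A → y ∈ A → h x ≡ h y → x ≡ y)
    injective-on-large-set {h} ff =
      let A , A∈U , unique = selector P isPartition in A , A∈U , λ {x} {y} x∈A y∈A e →
        let k , x∈P      = cover x
            s , _ , s≡   = unique k
            y∈P          = setOf⁺ (InBlock k) (subst (Between k) e (setOf⁻ (InBlock k) x∈P))
        in trans (sym (s≡ (∩⁺ A (P k) x∈A x∈P))) (s≡ (∩⁺ A (P k) y∈A y∈P))
      where
      exceed : ∀ n → ∃ λ x → n ≤ h x
      exceed n with N , b ← preimage-bounded ff n = N , ≮⇒≥ (<-irrefl refl ∘ b)
      t : ℕ → ℕ
      t zero    = 0
      t (suc k) = suc (h (proj₁ (exceed (t k))))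
      t-increasing : ∀ k → t k < t (suc k)
      t-increasing k = s≤s (proj₂ (exceed (t k)))
      Between : ℕ → ℕ → Set
      Between k n = t k ≤ n × n < t (suc k)
      InBlock : ℕ → ℕ → Set
      InBlock k x = Between k (h x)
      P : ℕ → 𝒫 ℕ
      P k = setOf (InBlock k)
      apart : ∀ {j k n} → j < k → Between j n → ¬ Between k n
      apart {j} {k} j<k (_ , n<) (≤n , _) = <-irrefl refl (≤-trans n< (≤-trans t≤ ≤n))
        where
        t≤ : t (suc j) ≤ t k
        t≤ with m≤n⇒m<n∨m≡n j<k
        ... | inj₁ l    = <⇒≤ (increasing t t-increasing l)
        ... | inj₂ refl = ≤-refl
      locate : ∀ n → ∃ λ k → Between k n
      locate zero    = 0 , z≤n , s≤s z≤n
      locate (suc n) with k , ≤n , n< ← locate n with m≤n⇒m<n∨m≡n n<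
      ... | inj₁ l = k , m≤n⇒m≤1+n ≤n , l
      ... | inj₂ e = suc k , ≤-reflexive (sym e) , subst (_< t (suc (suc k))) (sym e) (t-increasing (suc k))
      cover : ∀ x → ∃ λ k → x ∈ P k
      cover x with k , b ← locate (h x) = k , setOf⁺ (InBlock k) b
      isPartition : IsFinitePartition P
      isPartition = record
        { nonempty = λ k → let x , ≤hx = exceed (t k) in x , setOf⁺ (InBlock k) (≤hx , ≤-refl)
        ; disjoint = λ {m} {n} m≢n x x∈ →
            let x∈m , x∈n = ∩⁻ (P m) (P n) x∈
                b = setOf⁻ (InBlock m) x∈m
                c = setOf⁻ (InBlock n) x∈n
            in [ (λ m<n → apart m<n b c) , (λ n<m → apart n<m c b) ]′ (≢⇒<∨> m≢n)
        ; cover    = cover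
        ; finite   = λ k → let N , b = preimage-bounded ff (t (suc k))
                           in bounded⇒finite N (b ∘ proj₂ ∘ setOf⁻ (InBlock k))
        }
        where
        ≢⇒<∨> : ∀ {m n} → m ≢ n → m < n ⊎ n < m
        ≢⇒<∨> {m} {n} m≢n with <-cmp m n
        ... | tri< l _ _ = inj₁ l
        ... | tri≈ _ e _ = ⊥-elim (m≢n e)
        ... | tri> _ _ l = inj₂ l

    EDFin≰U* : ¬ (EDFin ≤KB U *)
    EDFin≰U* (f , ff , preserves) = contradiction
      (injective-on-large-set (finiteToOne-∘ {f = λ d → proj₁ (proj₁ d)} columnIndex-finiteToOne ff))
      where
      h : ℕ → ℕ
      h x = proj₁ (proj₁ (f x))
      module _ {A : 𝒫 ℕ} (inj : ∀ {x y} → x ∈ A → y ∈ A → h x ≡ h y → x ≡ y) where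
        InImage : Δ → Set
        InImage d = ∃ λ x → x ∈ A × f x ≡ d
        image : 𝒫 Δ
        image = setOf InImage
        thin : ∀ {d e} → InImage d → InImage e → proj₁ (proj₁ d) ≡ proj₁ (proj₁ e) → d ≡ e
        thin (x , x∈ , refl) (y , y∈ , refl) same = cong f (inj x∈ y∈ same)
        image∈EDFin : EDFin image
        image∈EDFin = thin⇒EDFin image λ d∈ e∈ → thin (setOf⁻ InImage d∈) (setOf⁻ InImage e∈)
      contradiction : ¬ (∃ λ A → U A × (∀ {x y} → x ∈ A → y ∈ A → h x ≡ h y → x ≡ y))
      contradiction (A , A∈U , inj) with A′ , A′∈U , e ← preserves (image inj) (image∈EDFin inj) =
        proper (⊆-closed disjoint (∩-closed A∈U A′∈U))
        where
        disjoint : (A ∩ A′) ⊆ ∅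
        disjoint {x} x∈ with x∈A , x∈A′ ← ∩⁻ A A′ x∈ =
          ⊥-elim (∁⁻ A′ (trans (sym (e x)) (setOf⁺ (InImage inj) (x , x∈A , refl))) x∈A′)

  -- Partial selectors

  -- C meets each P n in at most one point.

  IsPartialSelector : 𝒫 ℕ → (ℕ → 𝒫 ℕ) → Set
  IsPartialSelector C P = ∀ n {x y} → x ∈ C → y ∈ C → x ∈ P n → y ∈ P n → x ≡ y

  -- Every positive set has a positive subset that is a partial selector.

  Selective : Family ℕ → Set
  Selective J = ∀ B → (J ⁺) B → ∀ P → IsFinitePartition P →
                ∃ λ C → C ⊆ B × (J ⁺) C × IsPartialSelector C P

  block-unique : ∀ {P} → IsFinitePartition P → ∀ {m n x} → x ∈ P m → x ∈ P n → m ≡ n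
  block-unique {P} isP {m} {n} {x} x∈m x∈n with m ≟ n
  ... | yes e  = e
  ... | no m≢n = ⊥-elim (IsFinitePartition.disjoint isP m≢n x (∩⁺ (P m) (P n) x∈m x∈n))

  -- The bit of column A n at position k is the value of A at (n , k).

  entry-lookup : ∀ A {n k} (k≤n : k ≤ n) → lookup (column A n) (fromℕ< (s≤s k≤n)) ≡ A ((n , k) , k≤n)
  entry-lookup A {n} {k} k≤n = trans (lookup∘tabulate (entry A n) i) (same (toℕ-fromℕ< (s≤s k≤n)) (toℕ≤pred[n] i))
    where
    i = fromℕ< (s≤s k≤n)
    same : ∀ {l} → l ≡ k → (l≤n : l ≤ n) → A ((n , l) , l≤n) ≡ A ((n , k) , k≤n)
    same refl l≤n = cong (λ q → A ((n , k) , q)) (≤-irrelevant l≤n k≤n)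

  -- The number of points of A below d in the column of d.

  columnRank : 𝒫 Δ → Δ → ℕ
  columnRank A ((n , k) , k≤n) = rank (column A n) (fromℕ< (s≤s k≤n))

  columnRank< : ∀ A {m} → (∀ n → ∣ column A n ∣ < m) → ∀ {d} → d ∈ A → columnRank A d < m
  columnRank< A small {(n , k) , k≤n} d∈ = <-trans
    (rank<∣∣ (column A n) (fromℕ< (s≤s k≤n)) (trans (entry-lookup A k≤n) d∈)) (small n)

  columnRank-injective : ∀ A {d e} → d ∈ A → e ∈ A → proj₁ (proj₁ d) ≡ proj₁ (proj₁ e) →
                         columnRank A d ≡ columnRank A e → proj₂ (proj₁ d) ≡ proj₂ (proj₁ e)
  columnRank-injective A {(n , k) , k≤n} {(.n , l) , l≤n} d∈ e∈ refl same =
    trans (sym (toℕ-fromℕ< (s≤s k≤n))) (trans (cong toℕ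
      (rank-injective (column A n) _ _ (trans (entry-lookup A k≤n) d∈) (trans (entry-lookup A l≤n) e∈) same))
      (toℕ-fromℕ< (s≤s l≤n)))

  module _ {J : Family ℕ} (isIdeal : IsIdeal J) where
    open Ideal isIdeal

    -- The map f sends x to the point at height x of a column that depends only on
    -- the block of x.  The points of the preimage of A having a given column rank
    -- form a partial selector, since equal column and rank determine the point.

    selective : ¬ (EDFin ≤KB J) → Homogeneous-KB J → Selective J
    selective ED≰J homogeneous B positive P isP = by-contra λ none →
      ED≰J (≤KB-trans {K = J ↾ B} {L = J} (ED≤J↾B none) (proj₁ (homogeneous B positive)))
      where
      open IsFinitePartition isP
      block : ℕ → ℕ
      block x = proj₁ (cover x)
      bound : ℕ → ℕ
      bound n = proj₁ (finite⇒bounded (finite n))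
      -- Several blocks may share a column, as f separates points by height.
      f : ℕ → Δ
      f x = (bound (block x) , x) , <⇒≤ (proj₂ (finite⇒bounded (finite (block x))) (proj₂ (cover x)))
      module _ (none : ¬ (∃ λ C → C ⊆ B × (J ⁺) C × IsPartialSelector C P)) where
        selector∈J : ∀ C → C ⊆ B → IsPartialSelector C P → J C
        selector∈J C C⊆B sel = by-contra λ c → none (C , C⊆B , c , sel)
        module _ (A : 𝒫 Δ) where
          D : 𝒫 ℕ
          D = B ∩ (A ∘ f)
          HasRank LowRank : ℕ → ℕ → Set
          HasRank m x = x ∈ D × columnRank A (f x) ≡ m
          LowRank m x = x ∈ D × columnRank A (f x) < m
          rank-selector : ∀ m → IsPartialSelector (setOf (HasRank m)) P
          rank-selector m n {x} {y} x∈ y∈ x∈P y∈P =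
            let x∈D , rx = setOf⁻ (HasRank m) x∈
                y∈D , ry = setOf⁻ (HasRank m) y∈
                bx≡by = trans (block-unique isP (proj₂ (cover x)) x∈P)
                              (block-unique isP y∈P (proj₂ (cover y)))
            in columnRank-injective A {f x} {f y} (proj₂ (∩⁻ B (A ∘ f) x∈D)) (proj₂ (∩⁻ B (A ∘ f) y∈D))
                 (cong bound bx≡by) (trans rx (sym ry))
          lowRank∈J : ∀ m → J (setOf (LowRank m))
          lowRank∈J zero    = ∅∈J λ x∈ → n≮0 (proj₂ (setOf⁻ (LowRank 0) x∈))
          lowRank∈J (suc m) = ∪-cover
            (λ x∈ → let x∈D , r = setOf⁻ (LowRank (suc m)) x∈ in
              [ (λ r<m → inj₁ (setOf⁺ (LowRank m) (x∈D , r<m)))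
              , (λ r≡m → inj₂ (setOf⁺ (HasRank m) (x∈D , r≡m))) ]′ (m<1+n⇒m<n∨m≡n r))
            (lowRank∈J m)
            (selector∈J (setOf (HasRank m))
              (λ x∈ → proj₁ (∩⁻ B (A ∘ f) (proj₁ (setOf⁻ (HasRank m) x∈)))) (rank-selector m))
          D∈J : EDFin A → J D
          D∈J (m , small) = IsIdeal.⊆-closed isIdeal (λ x∈D → setOf⁺ (LowRank m)
            (x∈D , columnRank< A small {f _} (proj₂ (∩⁻ B (A ∘ f) x∈D)))) (lowRank∈J m)
        ED≤J↾B : EDFin ≤KB (J ↾ B)
        ED≤J↾B = f ∘ proj₁
               , injective⇒finiteToOne (λ e → Elem-≡ (cong (proj₂ ∘ proj₁) e))
               , λ A a → D A , D∈J A a , restrict A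
          where
          restrict : ∀ A (x : Elem B) → A (f (proj₁ x)) ≡ D A (proj₁ x)
          restrict A (x , x∈B) rewrite x∈B = refl

    -- A tower generating a Q-point disjoint from J

    -- The sequence of sets coded by w; every sequence of sets has a code.

    blocks : 𝒫 ℕ → ℕ → 𝒫 ℕ
    blocks w n x = w (pair n x)

    blocks-surjective : ∀ P → ∃ λ w → blocks w ≡ P
    blocks-surjective P = setOf Code , fe λ n → fe λ x → ⇔→≡ (mk⇔
      (λ h → let m , y , e , y∈ = setOf⁻ Code h in decodes (pair-injective e) y∈)
      (λ x∈ → setOf⁺ Code (n , x , refl , x∈)))
      where
      Code : ℕ → Set
      Code c = ∃ λ m → ∃ λ y → c ≡ pair m y × y ∈ P m
      decodes : ∀ {m n x y} → n ≡ m × x ≡ y → y ∈ P m → x ∈ P n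
      decodes (refl , refl) y∈ = y∈

    module Tower {below : 𝒫 ℕ → 𝒫 (𝒫 ℕ)} (isWellOrder : IsWellOrder below)
                 (lowerBounds : ∀ w → HasLowerBounds (Elem (below w)))
                 (sel : Selective J) where
      open IsWellOrder isWellOrder
      open IsIdeal isIdeal

      -- The requirements on the set C at stage w, given the earlier sets g.  The set w
      -- is used twice: C decides w, and C is a partial selector of the partition coded
      -- by w if w codes one.

      Task : (w : 𝒫 ℕ) → (Elem (below w) → 𝒫 ℕ) → 𝒫 ℕ → Set
      Task w g C = (J ⁺) C
                 × (∀ v → J (C ∖ g v))
                 × (C ⊆ w ⊎ C ⊆ ∁ w)
                 × (IsFinitePartition (blocks w) → IsPartialSelector C (blocks w))

      decide : ∀ {B} → (J ⁺) B → ∀ w → ∃ λ C → C ⊆ B × (J ⁺) C × (C ⊆ w ⊎ C ⊆ ∁ w)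
      decide {B} positive w with em {J (B ∩ w)}
      ... | no p  = B ∩ w , (λ x∈ → proj₁ (∩⁻ B w x∈)) , p , inj₁ λ x∈ → proj₂ (∩⁻ B w x∈)
      ... | yes p = B ∖ w , (λ x∈ → proj₁ (∖⁻ B w x∈))
                  , (λ q → positive (∪-cover (λ {x} x∈ → [ (λ x∈w → inj₁ (∩⁺ B w x∈ x∈w))
                                                        , (λ x∉w → inj₂ (∖⁺ B w x∈ x∉w)) ]′ (∈∪∁ w x)) p q))
                  , inj₂ λ x∈ → ∁⁺ w (proj₂ (∖⁻ B w x∈))

      select : ∀ {B} → (J ⁺) B → ∀ P → ∃ λ C → C ⊆ B × (J ⁺) C ×
               (IsFinitePartition P → IsPartialSelector C P)
      select {B} positive P with em {IsFinitePartition P}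
      ... | yes isP = let C , C⊆B , c , s = sel B positive P isP in C , C⊆B , c , λ _ → s
      ... | no ¬isP = B , id , positive , ⊥-elim ∘ ¬isP

      achieve : ∀ w g → Centered g → ∃ (Task w g)
      achieve w g centered =
        let B , positive , B≤g        = lowerBounds w g centered
            C , C⊆B , positive′ , dec = decide positive w
            D , D⊆C , positive″ , s   = select positive′ (blocks w)
        in D , positive″ , (λ v → ∖-mono (g v) (λ x∈ → C⊆B (D⊆C x∈)) (B≤g v))
         , shrink D⊆C dec , s
        where
        shrink : ∀ {C D} → D ⊆ C → C ⊆ w ⊎ C ⊆ ∁ w → D ⊆ w ⊎ D ⊆ ∁ w
        shrink D⊆C (inj₁ C⊆w) = inj₁ λ x∈ → C⊆w (D⊆C x∈)
        shrink D⊆C (inj₂ C⊆∁) = inj₂ λ x∈ → C⊆∁ (D⊆C x∈)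

      -- The value ∅ is never taken in the tower, by tower-task.

      pick : ∀ w → (Elem (below w) → 𝒫 ℕ) → 𝒫 ℕ
      pick w g with em {∃ (Task w g)}
      ... | yes (C , _) = C
      ... | no _        = ∅

      pick-task : ∀ w g → ∃ (Task w g) → Task w g (pick w g)
      pick-task w g achievable with em {∃ (Task w g)}
      ... | yes (_ , task) = task
      ... | no impossible  = ⊥-elim (impossible achievable)

      open FixPoint wellFounded (λ _ → 𝒫 ℕ) (λ w ih → pick w λ (v , v<w) → ih v<w)
        (λ w same → cong (pick w) (fe λ (v , v<w) → same v<w))

      tower : 𝒫 ℕ → 𝒫 ℕ
      tower = All.wfRec wellFounded 0ℓ (λ _ → 𝒫 ℕ) λ w ih → pick w λ (v , v<w) → ih v<w

      tower-task : ∀ w → Task w (tower ∘ proj₁) (tower w)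
      tower-task = All.wfRec wellFounded 0ℓ (λ w → Task w (tower ∘ proj₁) (tower w)) λ w ih →
        subst (Task w (tower ∘ proj₁)) (sym unfold-wfRec)
          (pick-task w (tower ∘ proj₁) (achieve w (tower ∘ proj₁) (chain⇒centered (tower ∘ proj₁)
            (λ (v , v<w) → proj₁ (ih v<w))
            (λ (u , u<w) (v , v<w) → compare (connected u v) (ih u<w) (ih v<w)))))
        where
        compare : ∀ {u v} → u ∈ below v ⊎ u ≡ v ⊎ v ∈ below u →
                  Task u (tower ∘ proj₁) (tower u) → Task v (tower ∘ proj₁) (tower v) →
                  J (tower u ∖ tower v) ⊎ J (tower v ∖ tower u)
        compare (inj₁ u<v)         _ t = inj₂ (proj₁ (proj₂ t) (_ , u<v))
        compare {u} (inj₂ (inj₁ refl)) _ _ =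
          inj₁ (∅∈J λ x∈ → let x∈u , x∉u = ∖⁻ (tower u) (tower u) x∈ in x∉u x∈u)
        compare (inj₂ (inj₂ v<u))  t _ = inj₁ (proj₁ (proj₂ t) (_ , v<u))

      -- The filter generated by the tower modulo J.

      U : Family ℕ
      U X = ∃ λ w → J (tower w ∖ X)

      ⊆⇒U : ∀ w {X} → tower w ⊆ X → U X
      ⊆⇒U w {X} ⊆X = w , ∅∈J λ x∈ → let x∈w , x∉X = ∖⁻ (tower w) X x∈ in x∉X (⊆X x∈w)

      ∖-∩ : ∀ A X Y → J (A ∖ X) → J (A ∖ Y) → J (A ∖ (X ∩ Y))
      ∖-∩ A X Y = ∪-cover λ {x} x∈ → let x∈A , x∉ = ∖⁻ A (X ∩ Y) x∈ in
        [ (λ x∈X → inj₂ (∖⁺ A Y x∈A λ x∈Y → x∉ (∩⁺ X Y x∈X x∈Y)))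
        , (λ x∉X → inj₁ (∖⁺ A X x∈A x∉X)) ]′ (∈∪∁ X x)

      U-∩ : ∀ {X Y} → U X → U Y → U (X ∩ Y)
      U-∩ {X} {Y} (u , p) (v , q) with connected u v
      ... | inj₁ u<v = v , ∖-∩ (tower v) X Y
              (∖-trans (tower v) (tower u) X (proj₁ (proj₂ (tower-task v)) (u , u<v)) p) q
      ... | inj₂ (inj₁ refl) = u , ∖-∩ (tower u) X Y p q
      ... | inj₂ (inj₂ v<u) = u , ∖-∩ (tower u) X Y p
              (∖-trans (tower u) (tower v) Y (proj₁ (proj₂ (tower-task u)) (v , v<u)) q)

      U-∁ : ∀ {X} → J X → U (∁ X)
      U-∁ {X} X∈J = ∅ , ⊆-closed (λ {x} x∈ →
        [ id , (λ x∉X → ⊥-elim (proj₂ (∖⁻ (tower ∅) (∁ X) x∈) (∁⁺ X x∉X))) ]′ (∈∪∁ X x)) X∈J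

      isUltrafilter : IsUltrafilter U
      isUltrafilter = record
        { ∩-closed = U-∩
        ; ⊆-closed = λ {A} {B} A⊆B (w , p) → w , ⊆-closed (λ x∈ →
            let x∈w , x∉B = ∖⁻ (tower w) B x∈ in ∖⁺ (tower w) A x∈w (λ x∈A → x∉B (A⊆B x∈A))) p
        ; cofinite = λ {A} fin → subst U (fe λ x → not-involutive (A x)) (U-∁ (finite fin))
        ; proper   = λ (w , p) → proj₁ (tower-task w)
            (⊆-closed (λ x∈ → ∖⁺ (tower w) ∅ x∈ λ ()) p)
        ; ultra    = λ A → decided A (proj₁ (proj₂ (proj₂ (tower-task A))))
        }
        where
        decided : ∀ A → tower A ⊆ A ⊎ tower A ⊆ ∁ A → U A ⊎ U (∁ A)
        decided A (inj₁ h) = inj₁ (⊆⇒U A h)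
        decided A (inj₂ h) = inj₂ (⊆⇒U A h)

      -- A partial selector is completed by one point of each block that it misses.

      complete : ∀ {P C} → IsFinitePartition P → IsPartialSelector C P →
                 ∃ λ A → C ⊆ A × (∀ n → ∃! _≡_ λ x → x ∈ A ∩ P n)
      complete {P} {C} isP partial = A , C⊆A , unique
        where
        open IsFinitePartition isP using (nonempty; cover)
        point : ∀ n → ∃ λ x → x ∈ P n × (∀ {y} → y ∈ C → y ∈ P n → x ≡ y)
        point n with em {∃ λ x → x ∈ C × x ∈ P n}
        ... | yes (x , x∈C , x∈P) = x , x∈P , λ y∈C y∈P → partial n x∈C y∈C x∈P y∈P
        ... | no missed = let x , x∈P = nonempty n
                          in x , x∈P , λ y∈C y∈P → ⊥-elim (missed (_ , y∈C , y∈P))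
        Chosen : ℕ → Set
        Chosen x = ∃ λ n → proj₁ (point n) ≡ x
        A : 𝒫 ℕ
        A = setOf Chosen
        C⊆A : C ⊆ A
        C⊆A {x} x∈C with n , x∈P ← cover x = setOf⁺ Chosen (n , proj₂ (proj₂ (point n)) x∈C x∈P)
        same : ∀ {n y} → Chosen y → y ∈ P n → proj₁ (point n) ≡ y
        same {n} (m , refl) y∈P with refl ← block-unique isP (proj₁ (proj₂ (point m))) y∈P = refl
        unique : ∀ n → ∃! _≡_ λ x → x ∈ A ∩ P n
        unique n = proj₁ (point n)
                 , ∩⁺ A (P n) (setOf⁺ Chosen (n , refl)) (proj₁ (proj₂ (point n)))
                 , λ y∈ → let y∈A , y∈P = ∩⁻ A (P n) y∈ in same (setOf⁻ Chosen y∈A) y∈P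

      isQPoint : IsQPoint U
      isQPoint = record { isUltrafilter = isUltrafilter ; selector = selector }
        where
        selector : ∀ P → IsFinitePartition P → ∃ λ A → U A × (∀ n → ∃! _≡_ λ x → x ∈ A ∩ P n)
        selector P isP with w , refl ← blocks-surjective P =
          let A , ⊆A , unique = complete isP (proj₂ (proj₂ (proj₂ (tower-task w))) isP)
          in A , ⊆⇒U w ⊆A , unique

      J≤P : J ≤P U *
      J≤P = id , id , λ B B∈J → ∁ B , U-∁ B∈J , λ x → sym (not-involutive (B x))

    weak-ultrafilter⇒ED≰ : (∃ λ U → IsQPoint U × ¬ IsWeakUltrafilter J U) → ¬ (EDFin ≤KB J)
    weak-ultrafilter⇒ED≰ (U , q , ¬weak) ED≤J = ¬weak λ J≤U → QPoint.EDFin≰U* q (≤KB-trans {K = J} {L = U *} ED≤J J≤U)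

    ≤P⇒≤KB : ∀ {K : Family ℕ} → J ≤P K → J ≤KB K
    ≤P⇒≤KB (f , inj , p) = f , injective⇒finiteToOne inj , p

    module _ (homogeneous : Homogeneous-KB J)
             (bounds : ∀ {I} → I ↣ 𝒫 ℕ → ¬ (𝒫 ℕ ↣ I) → HasLowerBounds I) where

      qpoint : ¬ (EDFin ≤KB J) → ∃ λ U → IsQPoint U × ¬ IsPoint J U
      qpoint ED≰J with below , isWellOrder , small ← initial-well-order =
        let open Tower isWellOrder (λ w → bounds (Elem↣ (below w)) (small w)) (selective ED≰J homogeneous)
        in U , isQPoint , λ isPoint → isPoint J≤P

      equivalences : let cond-a = ¬ (EDFin ≤KB J)
                         cond-b = ∃ λ (U : Family ℕ) → IsQPoint U × ¬ IsPoint J U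
                         cond-c = ∃ λ (U : Family ℕ) → IsQPoint U × ¬ IsWeakUltrafilter J U
                     in (cond-a ⇔ cond-b) × (cond-b ⇔ cond-c)
      equivalences = mk⇔ qpoint (weak-ultrafilter⇒ED≰ ∘ b⇒c)
                   , mk⇔ b⇒c (qpoint ∘ weak-ultrafilter⇒ED≰)
        where
        b⇒c : (∃ λ (U : Family ℕ) → IsQPoint U × ¬ IsPoint J U) →
              ∃ λ (U : Family ℕ) → IsQPoint U × ¬ IsWeakUltrafilter J U
        b⇒c (U , q , ¬point) = U , q , λ weak → ¬point λ J≤P → weak (≤P⇒≤KB {K = U *} J≤P)

theorem8p5 :
    (∀ {ℓ} → ExcludedMiddle ℓ) →
    (∀ {a b} → Extensionality a b) →
    (J : Family ℕ) → IsIdeal J → IsP⁺ J → Homogeneous-KB J →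
    let cond-a = ¬ (EDFin ≤KB J)
        cond-b = ∃ λ (U : Family ℕ) → IsQPoint U × ¬ IsPoint J U
        cond-c = ∃ λ (U : Family ℕ) → IsQPoint U × ¬ IsWeakUltrafilter J U
    in (CH → (cond-a ⇔ cond-b) × (cond-b ⇔ cond-c))
     × (Fσ J → 𝔭≡𝔠 → (cond-a ⇔ cond-b) × (cond-b ⇔ cond-c))
theorem8p5 em fe J isIdeal p⁺ homogeneous =
  (λ ch → equivalences isIdeal homogeneous λ inj small →
    countable⇒lower-bounds isIdeal p⁺ (CH⇒countable ch inj small)) ,
  (λ fσ 𝔭≡𝔠 → equivalences isIdeal homogeneous λ _ → small⇒lower-bounds isIdeal fσ 𝔭≡𝔠)
  where
  open Classical em fe
  open Ideal
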